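{- Let $n,\delta\in\mathbb{N}$ with $\delta\ge3$. If $G$ is a connected $C_4$-free graph of order $n$ and minimum degree $\delta$, then \[\pi(G)\le\frac54\left\lfloor\frac{n}{\delta^2-2\lfloor\delta/2\rfloor+1}\right\rfloor+\frac{147}{32}.\]
   Context: $C_4$-free means containing no 4-cycle as a subgraph. For a connected graph $G$ of order $n\ge2$ and vertex $v$, $\overline{\sigma}(v)=\frac{1}{n-1}\sum_w d(v,w)$; the proximity is $\pi(G)=\min_v\overline{\sigma}(v)$. -}

module Defs where

open import Data.Nat as ℕ using (ℕ; zero; suc; _<_; _≤_)
open import Data.Bool using (Bool; true; false; if_then_else_)
open import Data.Fin using (Fin)
open import Data.List using (List; map; allFin)
open import Data.Nat.ListAction using (sum)
open import Data.Integer using (+_)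
open import Data.Rational as ℚ using (ℚ; _⊓_; _/_)
open import Data.Product using (_×_; ∃)
open import Relation.Binary.PropositionalEquality using (_≡_; _≢_)
open import Relation.Nullary using (¬_)

record Graph (n : ℕ) : Set where
  field
    adj   : Fin n → Fin n → Bool
    sym   : ∀ u v → adj u v ≡ adj v u
    irrefl : ∀ v → adj v v ≡ false
open Graph public

module _ {n : ℕ} (G : Graph n) where

  degree : Fin n → ℕ
  degree v = sum (map (λ w → if adj G v w then 1 else 0) (allFin n))

  MinDegree : ℕ → Set
  MinDegree δ = (∀ v → δ ≤ degree v) × ∃ λ v → degree v ≡ δ

  data Walk : ℕ → Fin n → Fin n → Set where
    here : ∀ {v} → Walk zero v v
    step : ∀ {k u v w} → adj G u v ≡ true → Walk k v w → Walk (suc k) u w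

  Connected : Set
  Connected = ∀ v w → ∃ λ k → Walk k v w

  IsDist : Fin n → Fin n → ℕ → Set
  IsDist v w k = Walk k v w × (∀ j → j < k → ¬ Walk j v w)

  C4Free : Set
  C4Free = ∀ a b c d → a ≢ b → a ≢ c → a ≢ d → b ≢ c → b ≢ d → c ≢ d →
           adj G a b ≡ true → adj G b c ≡ true → adj G c d ≡ true →
           adj G d a ≡ true → ⊥′
    where open import Data.Empty renaming (⊥ to ⊥′)

-- average of a natural-number total over k values (k = 0 never used)
avg : ℕ → ℕ → ℚ
avg s zero = ℚ.0ℚ
avg s (suc k) = (+ s) / suc k

minFin : ∀ {k} → (Fin (suc k) → ℚ) → ℚ
minFin {zero} f = f Fin.zero
  where import Data.Fin as Fin
minFin {suc k} f = f Fin.zero ⊓ minFin (λ i → f (Fin.suc i))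
  where import Data.Fin as Fin

transmission : ∀ {n} → (Fin n → Fin n → ℕ) → Fin n → ℕ
transmission {n} d v = sum (map (d v) (allFin n))

avgDist : ∀ {n} → (Fin n → Fin n → ℕ) → Fin n → ℚ
avgDist {n} d v = avg (transmission d v) (n ℕ.∸ 1)

-- proximity π(G) = min_v σ̄(v)  (order 0 gets a dummy value 0)
proximity : ∀ {n} → (Fin n → Fin n → ℕ) → ℚ
proximity {zero} d = ℚ.0ℚ
proximity {suc k} d = minFin (avgDist d)

{-# OPTIONS --safe #-}
module Submission where

-- Let M = δ² - 2⌊δ/2⌋ + 1. In a C₄-free graph every ball of radius 2 has at least M vertices:
-- a vertex w ≠ a has at most one common neighbour with a, so only the edges inside the
-- neighbourhood of a are lost when the neighbours of the neighbours of a are counted, and these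
-- edges form a matching.
-- Choose centres greedily, each at distance at most 5 from an earlier one, with disjoint balls
-- of radius 2 and such that every vertex is within distance 4 of a centre; give each vertex to a
-- centre, its own one if it lies in a ball. This yields a tree of cells of weight W ≥ M, where
-- moving a cell to its centre costs S ≤ 4W - 2M. Moving everything to a median of the tree, by
-- repeatedly merging a cell of weight at most n/2 into a neighbour, preserves two bounds on the
-- cost S of a cell:
--   2MS + MW ≤ 5W²   and   4MS ≤ (W - M)(18M + 5n) + 8M².
-- The second one at W = n, together with n < M(⌊n/M⌋ + 1), is the bound on the proximity.

open import Defs
open import Data.Bool using (Bool; true; false; if_then_else_)
open import Data.Empty using (⊥-elim)
open import Data.Fin as Fin using (Fin; zero; suc)
open import Data.Fin.Properties as Fin using (any?)
import Data.Integer as ℤ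
import Data.Integer.Properties as ℤ
open import Data.List using (allFin; map; tabulate)
open import Data.List.Properties using (map-tabulate)
import Data.Nat.ListAction as List using (sum)
open import Data.Nat
  using (ℕ; zero; suc; _≤_; _<_; _*_; _∸_; _+_; _/_; _%_; z≤n; s≤s; s≤s⁻¹; _≤?_; NonZero; >-nonZero)
open import Data.Nat.DivMod using (m≡m%n+[m/n]*n; m%n<n; m/n*n≤m; m*n/n≡m; /-monoˡ-≤)
open import Data.Nat.Properties
open import Data.Nat.Tactic.RingSolver using (solve-∀)
open import Data.Product using (_×_; _,_; ∃; ∃-syntax; proj₁; proj₂)
open import Data.Rational as ℚ using (ℚ)
import Data.Rational.Properties as ℚ
import Data.Rational.Unnormalised as ℚᵘ
import Data.Rational.Unnormalised.Properties as ℚᵘ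
open import Data.Vec.Functional using (_∷_)
open import Function using (_∘_)
open import Relation.Binary.PropositionalEquality as ≡
  using (_≡_; _≢_; refl; cong; cong₂; subst; subst₂)
open import Relation.Nullary using (¬_; Dec; yes; no; does; contradiction; ¬?)
open import Relation.Nullary.Decidable using (dec-true; dec-false; decidable-stable)
open import Algebra.Properties.Semiring.Sum +-*-semiring renaming (sum to ∑)

-- Finite sums of natural numbers.

𝟙 : Bool → ℕ
𝟙 b = if b then 1 else 0

∑-mono : ∀ {n} {f g : Fin n → ℕ} → (∀ i → f i ≤ g i) → ∑ f ≤ ∑ g
∑-mono {zero}  f≤g = z≤n
∑-mono {suc n} f≤g = +-mono-≤ (f≤g zero) (∑-mono (f≤g ∘ suc))

∑-mono-< : ∀ {n} {f g : Fin n → ℕ} → (∀ i → f i ≤ g i) → ∀ i → f i < g i → ∑ f < ∑ g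
∑-mono-< f≤g zero    fᵢ<gᵢ = +-mono-<-≤ fᵢ<gᵢ (∑-mono (f≤g ∘ suc))
∑-mono-< f≤g (suc i) fᵢ<gᵢ = +-mono-≤-< (f≤g zero) (∑-mono-< (f≤g ∘ suc) i fᵢ<gᵢ)

∑-zero : ∀ {n} {f : Fin n → ℕ} → (∀ i → f i ≡ 0) → ∑ f ≡ 0
∑-zero {n} f≡0 = ≡.trans (sum-cong-≗ f≡0) (sum-replicate-zero n)

∑-one : ∀ n → ∑ {n} (λ _ → 1) ≡ n
∑-one zero    = refl
∑-one (suc n) = cong suc (∑-one n)

∑-diagonal : ∀ {n} (j : Fin n) (f : Fin n → ℕ) → ∑ (λ i → 𝟙 (does (j Fin.≟ i)) * f i) ≡ f j
∑-diagonal {suc n} zero f = ≡.trans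
  (cong₂ _+_ (*-identityˡ (f zero)) (∑-zero {n} {λ i → 𝟙 (does (zero Fin.≟ suc i)) * f (suc i)} (λ _ → refl)))
  (+-identityʳ _)
∑-diagonal (suc j) f = ∑-diagonal j (f ∘ suc)

∑-at-most-one : ∀ {n} (f : Fin n → ℕ) → (∀ i → f i ≤ 1) →
                (∀ i j → 0 < f i → 0 < f j → i ≡ j) → ∑ f ≤ 1
∑-at-most-one {zero}  f f≤1 unique = z≤n
∑-at-most-one {suc n} f f≤1 unique with f zero in f₀ | f≤1 zero
... | zero  | _ = ∑-at-most-one (f ∘ suc) (f≤1 ∘ suc)
                    (λ i j p q → Fin.suc-injective (unique (suc i) (suc j) p q))
... | suc a | s≤s a≤0 = s≤s (≤-trans (≤-reflexive (cong (a +_) (∑-zero rest))) (≤-trans (≤-reflexive (+-identityʳ a)) a≤0))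
  where
  rest : ∀ i → f (suc i) ≡ 0
  rest i with f (suc i) in fᵢ
  ... | zero  = refl
  ... | suc _ with unique zero (suc i) (subst (0 <_) (≡.sym f₀) (s≤s z≤n)) (subst (0 <_) (≡.sym fᵢ) (s≤s z≤n))
  ...   | ()

-- By symmetry the first row and the first column have equal sums, so splitting them off removes an
-- even amount. Applied to adjacency among the neighbours of a vertex, this is the handshake
-- argument.
∑-symmetric-even : ∀ {n} (f : Fin n → Fin n → ℕ) → (∀ i → f i i ≡ 0) → (∀ i j → f i j ≡ f j i) →
                   ∃[ m ] ∑ (λ i → ∑ (f i)) ≡ 2 * m
∑-symmetric-even {zero}  f diag symm = 0 , refl
∑-symmetric-even {suc n} f diag symm
  with ∑-symmetric-even (λ i j → f (suc i) (suc j)) (diag ∘ suc) (λ i j → symm (suc i) (suc j))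
... | m , eq = row + m , (begin
  (f zero zero + row) + ∑ (λ i → f (suc i) zero + ∑ (f (suc i) ∘ suc))
    ≡⟨ cong₂ _+_ (cong (_+ row) (diag zero)) (∑-distrib-+ (λ i → f (suc i) zero) (λ i → ∑ (f (suc i) ∘ suc))) ⟩
  row + (∑ (λ i → f (suc i) zero) + ∑ (λ i → ∑ (f (suc i) ∘ suc)))
    ≡⟨ cong (row +_) (cong₂ _+_ (sum-cong-≗ (λ i → symm (suc i) zero)) eq) ⟩
  row + (row + 2 * m)
    ≡⟨ regroup row m ⟩
  2 * (row + m) ∎)
  where
  open ≡.≡-Reasoning
  row = ∑ (f zero ∘ suc)
  regroup : ∀ r m → r + (r + 2 * m) ≡ 2 * (r + m)
  regroup = solve-∀

sum-allFin : ∀ {n} (f : Fin n → ℕ) → List.sum (map f (allFin n)) ≡ ∑ f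
sum-allFin {n} f = ≡.trans (cong List.sum (map-tabulate (λ i → i) f)) (sum-tabulate f)
  where
  sum-tabulate : ∀ {k} (g : Fin k → ℕ) → List.sum (tabulate g) ≡ ∑ g
  sum-tabulate {zero}  g = refl
  sum-tabulate {suc k} g = cong (g zero +_) (sum-tabulate (g ∘ suc))

-- Trees of weighted clusters and their collapse onto a median.

-- A tree in leaf-first order: `c zero` is a leaf whose parent `p` is among the remaining centres,
-- so peeling off index zero is induction on the tree.
data Linked {V : Set} (d : V → V → ℕ) : ∀ {k} → (Fin k → V) → Set where
  root   : {c : Fin 1 → V} → Linked d c
  attach : ∀ {k} {c : Fin (suc k) → V} (p : Fin k) → d (c zero) (c (suc p)) ≤ 5 →
           Linked d (c ∘ suc) → Linked d c

module Clustering {V : Set} (d : V → V → ℕ)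
         (d-refl : ∀ x → d x x ≡ 0) (d-sym : ∀ x y → d x y ≡ d y x)
         (d-triangle : ∀ x y z → d x z ≤ d x y + d y z)
         (n M : ℕ) where

  -- A set of `weight` vertices, transported to the centre at total distance at most `cost`.
  -- Both cost bounds survive the merging of a cluster with at most half of the n vertices
  -- into a neighbouring one; the second is the one that bounds the proximity.
  record Cluster (c : V) : Set where
    field
      weight     : ℕ
      cost       : ℕ
      M≤weight   : M ≤ weight
      quadratic  : 2 * (M * cost) + M * weight ≤ 5 * (weight * weight)
      linear     : 4 * (M * cost) + M * (18 * M + 5 * n) ≤ weight * (18 * M + 5 * n) + 8 * (M * M)
  open Cluster

  Light : ∀ {c} → Cluster c → Set
  Light C = 2 * weight C ≤ n

  -- With `W = M + e` the slack is `M * e + 5 * (e * e)`. Equality at `W = M`, `S = 2 * M` explains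
  -- the coefficient 5.
  initial-quadratic : ∀ W S → M ≤ W → S + 2 * M ≤ 4 * W → 2 * (M * S) + M * W ≤ 5 * (W * W)
  initial-quadratic W S M≤W S≤ with m≤n⇒∃[o]m+o≡n M≤W
  ... | e , refl = +-cancelʳ-≤ (4 * (M * M)) _ _ (begin
    2 * (M * S) + M * (M + e) + 4 * (M * M) ≡⟨ eq₁ M S e ⟩
    2 * (M * (S + 2 * M)) + M * (M + e)     ≤⟨ +-monoˡ-≤ _ (*-monoʳ-≤ 2 (*-monoʳ-≤ M S≤)) ⟩
    2 * (M * (4 * (M + e))) + M * (M + e)   ≤⟨ m≤m+n _ (M * e + 5 * (e * e)) ⟩
    2 * (M * (4 * (M + e))) + M * (M + e) + (M * e + 5 * (e * e)) ≡⟨ eq₂ M e ⟩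
    5 * ((M + e) * (M + e)) + 4 * (M * M) ∎)
    where
    open ≤-Reasoning
    eq₁ : ∀ M S e → 2 * (M * S) + M * (M + e) + 4 * (M * M) ≡ 2 * (M * (S + 2 * M)) + M * (M + e)
    eq₁ = solve-∀
    eq₂ : ∀ M e → 2 * (M * (4 * (M + e))) + M * (M + e) + (M * e + 5 * (e * e)) ≡
                  5 * ((M + e) * (M + e)) + 4 * (M * M)
    eq₂ = solve-∀

  -- The slack is `e * (2 * M + 5 * n)`; the term `8 * (M * M)` makes the extremal case `W = M`,
  -- `S = 2 * M` an equality.
  initial-linear : ∀ W S → M ≤ W → S + 2 * M ≤ 4 * W →
    4 * (M * S) + M * (18 * M + 5 * n) ≤ W * (18 * M + 5 * n) + 8 * (M * M)
  initial-linear W S M≤W S≤ with m≤n⇒∃[o]m+o≡n M≤W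
  ... | e , refl = +-cancelʳ-≤ (8 * (M * M)) _ _ (begin
    4 * (M * S) + M * (18 * M + 5 * n) + 8 * (M * M) ≡⟨ eq₁ M S n ⟩
    4 * (M * (S + 2 * M)) + M * (18 * M + 5 * n)     ≤⟨ +-monoˡ-≤ _ (*-monoʳ-≤ 4 (*-monoʳ-≤ M S≤)) ⟩
    4 * (M * (4 * (M + e))) + M * (18 * M + 5 * n)   ≤⟨ m≤m+n _ (e * (2 * M + 5 * n)) ⟩
    4 * (M * (4 * (M + e))) + M * (18 * M + 5 * n) + e * (2 * M + 5 * n) ≡⟨ eq₂ M e n ⟩
    (M + e) * (18 * M + 5 * n) + 8 * (M * M) + 8 * (M * M) ∎)
    where
    open ≤-Reasoning
    eq₁ : ∀ M S n → 4 * (M * S) + M * (18 * M + 5 * n) + 8 * (M * M) ≡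
                    4 * (M * (S + 2 * M)) + M * (18 * M + 5 * n)
    eq₁ = solve-∀
    eq₂ : ∀ M e n → 4 * (M * (4 * (M + e))) + M * (18 * M + 5 * n) + e * (2 * M + 5 * n) ≡
                    (M + e) * (18 * M + 5 * n) + 8 * (M * M) + 8 * (M * M)
    eq₂ = solve-∀

  initial : ∀ {c} W S → M ≤ W → S + 2 * M ≤ 4 * W → Cluster c
  initial W S M≤W S≤ = record
    { weight = W ; cost = S ; M≤weight = M≤W
    ; quadratic = initial-quadratic W S M≤W S≤ ; linear = initial-linear W S M≤W S≤ }

  -- The price of moving a light cluster over distance 5. `quadratic` bounds it by `10W² + 18MW`,
  -- and lightness replaces a factor `2W` by `n`; this is the origin of `18 * M + 5 * n`.
  branch-cost : ∀ {c} (C : Cluster c) → Light C →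
                4 * (M * (cost C + 5 * weight C)) ≤ weight C * (18 * M + 5 * n)
  branch-cost C light = begin
    4 * (M * (S + 5 * W))                    ≡⟨ eq₁ M S W ⟩
    2 * (2 * (M * S) + M * W) + 18 * (M * W) ≤⟨ +-monoˡ-≤ _ (*-monoʳ-≤ 2 (quadratic C)) ⟩
    2 * (5 * (W * W)) + 18 * (M * W)         ≡⟨ eq₂ M W ⟩
    5 * W * (2 * W) + 18 * (M * W)           ≤⟨ +-monoˡ-≤ _ (*-monoʳ-≤ (5 * W) light) ⟩
    5 * W * n + 18 * (M * W)                 ≡⟨ eq₃ M W n ⟩
    W * (18 * M + 5 * n)                     ∎
    where
    open ≤-Reasoning
    S = cost C
    W = weight C
    eq₁ : ∀ M S W → 4 * (M * (S + 5 * W)) ≡ 2 * (2 * (M * S) + M * W) + 18 * (M * W)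
    eq₁ = solve-∀
    eq₂ : ∀ M W → 2 * (5 * (W * W)) + 18 * (M * W) ≡ 5 * W * (2 * W) + 18 * (M * W)
    eq₂ = solve-∀
    eq₃ : ∀ M W n → 5 * W * n + 18 * (M * W) ≡ W * (18 * M + 5 * n)
    eq₃ = solve-∀

  -- Moving weight `W′` over distance 5 adds `10 * (M * W′)` on the left; since `M ≤ W`, the cross
  -- term of the square pays for it.
  merge-quadratic : ∀ {c c′} (C′ : Cluster c′) (C : Cluster c) →
    2 * (M * (cost C + (cost C′ + 5 * weight C′))) + M * (weight C + weight C′) ≤
    5 * ((weight C + weight C′) * (weight C + weight C′))
  merge-quadratic C′ C = begin
    2 * (M * (S + (S′ + 5 * W′))) + M * (W + W′) ≡⟨ eq₁ M S S′ W W′ ⟩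
    (2 * (M * S) + M * W) + (2 * (M * S′) + M * W′) + 10 * (M * W′)
      ≤⟨ +-mono-≤ (+-mono-≤ (quadratic C) (quadratic C′)) (*-monoʳ-≤ 10 (*-monoˡ-≤ W′ (M≤weight C))) ⟩
    5 * (W * W) + 5 * (W′ * W′) + 10 * (W * W′) ≡⟨ eq₂ W W′ ⟩
    5 * ((W + W′) * (W + W′)) ∎
    where
    open ≤-Reasoning
    S  = cost C
    W  = weight C
    S′ = cost C′
    W′ = weight C′
    eq₁ : ∀ M S S′ W W′ → 2 * (M * (S + (S′ + 5 * W′))) + M * (W + W′) ≡
          (2 * (M * S) + M * W) + (2 * (M * S′) + M * W′) + 10 * (M * W′)
    eq₁ = solve-∀
    eq₂ : ∀ W W′ → 5 * (W * W) + 5 * (W′ * W′) + 10 * (W * W′) ≡ 5 * ((W + W′) * (W + W′))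
    eq₂ = solve-∀

  -- A light branch pays only its weight times `Q`, so the bound is additive: `M * Q` and
  -- `8 * (M * M)` enter once, through the receiving cluster.
  merge-linear : ∀ {c c′} (C′ : Cluster c′) → Light C′ → (C : Cluster c) →
    4 * (M * (cost C + (cost C′ + 5 * weight C′))) + M * (18 * M + 5 * n) ≤
    (weight C + weight C′) * (18 * M + 5 * n) + 8 * (M * M)
  merge-linear C′ light C = begin
    4 * (M * (S + B)) + M * Q             ≡⟨ eq₁ M S B Q ⟩
    4 * (M * S) + M * Q + 4 * (M * B)     ≤⟨ +-mono-≤ (linear C) (branch-cost C′ light) ⟩
    W * Q + 8 * (M * M) + W′ * Q          ≡⟨ eq₂ M W W′ Q ⟩
    (W + W′) * Q + 8 * (M * M)            ∎
    where
    open ≤-Reasoning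
    S  = cost C
    W  = weight C
    W′ = weight C′
    B  = cost C′ + 5 * W′
    Q  = 18 * M + 5 * n
    eq₁ : ∀ M S B Q → 4 * (M * (S + B)) + M * Q ≡ 4 * (M * S) + M * Q + 4 * (M * B)
    eq₁ = solve-∀
    eq₂ : ∀ M W W′ Q → W * Q + 8 * (M * M) + W′ * Q ≡ (W + W′) * Q + 8 * (M * M)
    eq₂ = solve-∀

  merge : ∀ {c c′} (C′ : Cluster c′) → Light C′ → Cluster c → Cluster c
  merge C′ light C = record
    { weight    = weight C + weight C′
    ; cost      = cost C + (cost C′ + 5 * weight C′)
    ; M≤weight  = m≤n⇒m≤n+o (weight C′) (M≤weight C)
    ; quadratic = merge-quadratic C′ C
    ; linear    = merge-linear C′ light C
    }

  Clusters : ∀ {k} → (Fin k → V) → Set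
  Clusters c = ∀ i → Cluster (c i)

  total : ∀ {k} (c : Fin k → V) → Clusters c → ℕ
  total c Cs = ∑ (λ i → weight (Cs i))

  -- For the cells of a packing this dominates the transmission of `x`: every vertex travels to its
  -- centre, and from there to `x`.
  spread : ∀ {k} (c : Fin k → V) → V → Clusters c → ℕ
  spread c x Cs = ∑ (λ i → cost (Cs i) + weight (Cs i) * d x (c i))

  modify : ∀ {k} {P : Fin k → Set} (p : Fin k) → (P p → P p) → (∀ i → P i) → ∀ i → P i
  modify zero    g f zero    = g (f zero)
  modify zero    g f (suc i) = f (suc i)
  modify (suc p) g f zero    = f zero
  modify (suc p) g f (suc i) = modify p g (f ∘ suc) i

  ∑-modify : ∀ {k} {P : Fin k → Set} (F : ∀ i → P i → ℕ) (p : Fin k) (g : P p → P p) (e : ℕ) →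
             (∀ a → F p (g a) ≡ F p a + e) → (f : ∀ i → P i) →
             ∑ (λ i → F i (modify {P = P} p g f i)) ≡ ∑ (λ i → F i (f i)) + e
  ∑-modify F zero g e Fg f = ≡.trans
    (cong (_+ rest) (Fg (f zero)))
    (swap (F zero (f zero)) e rest)
    where
    rest = ∑ (λ i → F (suc i) (f (suc i)))
    swap : ∀ a b c → a + b + c ≡ a + c + b
    swap = solve-∀
  ∑-modify F (suc p) g e Fg f = ≡.trans
    (cong (F zero (f zero) +_) (∑-modify (F ∘ suc) p g e Fg (f ∘ suc)))
    (≡.sym (+-assoc (F zero (f zero)) _ e))

  absorb : ∀ {k} (c : Fin (suc k) → V) (Cs : Clusters c) → Fin k → Light (Cs zero) → Clusters (c ∘ suc)
  absorb c Cs p light = modify {P = Cluster ∘ c ∘ suc} p (merge (Cs zero) light) (Cs ∘ suc)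

  total-absorb : ∀ {k} (c : Fin (suc k) → V) (Cs : Clusters c) p (light : Light (Cs zero)) →
                 total (c ∘ suc) (absorb c Cs p light) ≡ total c Cs
  total-absorb c Cs p light = ≡.trans
    (∑-modify {P = Cluster ∘ c ∘ suc} (λ _ → weight) p (merge (Cs zero) light) (weight (Cs zero)) (λ _ → refl) (Cs ∘ suc))
    (+-comm _ (weight (Cs zero)))

  -- Routing from `x` to the leaf through its parent lengthens the way by at most 5 per unit of
  -- weight, exactly the surcharge in `merge`.
  spread-absorb : ∀ {k} (c : Fin (suc k) → V) x (Cs : Clusters c) p (light : Light (Cs zero)) →
                  d (c zero) (c (suc p)) ≤ 5 → spread c x Cs ≤ spread (c ∘ suc) x (absorb c Cs p light)
  spread-absorb c x Cs p light near = begin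
    (S + W * d x (c zero)) + rest
      ≤⟨ +-monoˡ-≤ rest (+-monoʳ-≤ S (*-monoʳ-≤ W (≤-trans (d-triangle x (c (suc p)) (c zero))
           (+-monoʳ-≤ _ (≤-trans (≤-reflexive (d-sym (c (suc p)) (c zero))) near))))) ⟩
    (S + W * (D + 5)) + rest
      ≡⟨ eq₁ S W D rest ⟩
    rest + (S + 5 * W + W * D)
      ≡⟨ ∑-modify {P = Cluster ∘ c ∘ suc} (λ i C → cost C + weight C * d x (c (suc i))) p (merge (Cs zero) light) _
           (λ C → eq₂ (cost C) (weight C) S W D) (Cs ∘ suc) ⟨
    spread (c ∘ suc) x (absorb c Cs p light) ∎
    where
    open ≤-Reasoning
    S = cost (Cs zero)
    W = weight (Cs zero)
    D = d x (c (suc p))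
    rest = spread (c ∘ suc) x (Cs ∘ suc)
    eq₁ : ∀ S W D r → (S + W * (D + 5)) + r ≡ r + (S + 5 * W + W * D)
    eq₁ = solve-∀
    eq₂ : ∀ S₁ W₁ S W D → S₁ + (S + 5 * W) + (W₁ + W) * D ≡ S₁ + W₁ * D + (S + 5 * W + W * D)
    eq₂ = solve-∀

  spread-shift : ∀ {k} (c : Fin k → V) x y (Cs : Clusters c) → d x y ≤ 5 →
                 spread c x Cs ≤ spread c y Cs + 5 * total c Cs
  spread-shift c x y Cs near = begin
    spread c x Cs ≤⟨ ∑-mono pointwise ⟩
    ∑ (λ i → (cost (Cs i) + weight (Cs i) * d y (c i)) + 5 * weight (Cs i))
      ≡⟨ ∑-distrib-+ (λ i → cost (Cs i) + weight (Cs i) * d y (c i)) (λ i → 5 * weight (Cs i)) ⟩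
    spread c y Cs + ∑ (λ i → 5 * weight (Cs i))
      ≡⟨ cong (spread c y Cs +_) (*-distribˡ-sum 5 (weight ∘ Cs)) ⟨
    spread c y Cs + 5 * total c Cs ∎
    where
    open ≤-Reasoning
    eq : ∀ S W D → S + W * (5 + D) ≡ S + W * D + 5 * W
    eq = solve-∀
    pointwise : ∀ i → cost (Cs i) + weight (Cs i) * d x (c i) ≤
                      (cost (Cs i) + weight (Cs i) * d y (c i)) + 5 * weight (Cs i)
    pointwise i = begin
      cost (Cs i) + weight (Cs i) * d x (c i)
        ≤⟨ +-monoʳ-≤ (cost (Cs i)) (*-monoʳ-≤ (weight (Cs i)) (≤-trans (d-triangle x y (c i)) (+-monoˡ-≤ _ near))) ⟩
      cost (Cs i) + weight (Cs i) * (5 + d y (c i))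
        ≡⟨ eq (cost (Cs i)) (weight (Cs i)) (d y (c i)) ⟩
      (cost (Cs i) + weight (Cs i) * d y (c i)) + 5 * weight (Cs i) ∎

  -- Since `cluster` is again a `Cluster`, its cost bounds carry over to the spread seen from `c j`.
  record Collapsed {k} (c : Fin k → V) (Cs : Clusters c) (j : Fin k) : Set where
    field
      cluster  : Cluster (c j)
      weight≡  : weight cluster ≡ total c Cs
      spread≤  : spread c (c j) Cs ≤ cost cluster
  open Collapsed

  collapse-single : (c : Fin 1 → V) (Cs : Clusters c) → Collapsed c Cs zero
  collapse-single c Cs = record
    { cluster = Cs zero
    ; weight≡ = ≡.sym (+-identityʳ _)
    ; spread≤ = ≤-reflexive (begin
        S + W * d (c zero) (c zero) + 0 ≡⟨ cong (λ z → S + W * z + 0) (d-refl (c zero)) ⟩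
        S + W * 0 + 0                   ≡⟨ eq S W ⟩
        S                               ∎)
    }
    where
    open ≡.≡-Reasoning
    S = cost (Cs zero)
    W = weight (Cs zero)
    eq : ∀ S W → S + W * 0 + 0 ≡ S
    eq = solve-∀

  collapse-onto-parent : ∀ {k} (c : Fin (suc k) → V) (Cs : Clusters c) p (light : Light (Cs zero)) →
    d (c zero) (c (suc p)) ≤ 5 → ∀ j → Collapsed (c ∘ suc) (absorb c Cs p light) j → Collapsed c Cs (suc j)
  collapse-onto-parent c Cs p light near j K = record
    { cluster = cluster K
    ; weight≡ = ≡.trans (weight≡ K) (total-absorb c Cs p light)
    ; spread≤ = ≤-trans (spread-absorb c (c (suc j)) Cs p light near) (spread≤ K)
    }

  -- The link is used in the opposite direction: everything else, gathered at the parent, is the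
  -- light branch that merges into the leaf.
  collapse-onto-leaf : ∀ {k} (c : Fin (suc k) → V) (Cs : Clusters c) p →
    d (c zero) (c (suc p)) ≤ 5 → 2 * total (c ∘ suc) (Cs ∘ suc) ≤ n → Collapsed (c ∘ suc) (Cs ∘ suc) p → Collapsed c Cs zero
  collapse-onto-leaf c Cs p near half K = record
    { cluster = merge (cluster K) (subst (λ w → 2 * w ≤ n) (≡.sym (weight≡ K)) half) (Cs zero)
    ; weight≡ = cong (weight (Cs zero) +_) (weight≡ K)
    ; spread≤ = begin
        (S + W * d (c zero) (c zero)) + spread (c ∘ suc) (c zero) (Cs ∘ suc)
          ≡⟨ cong (_+ spread (c ∘ suc) (c zero) (Cs ∘ suc)) (≡.trans (cong (λ z → S + W * z) (d-refl (c zero))) (eq S W)) ⟩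
        S + spread (c ∘ suc) (c zero) (Cs ∘ suc)
          ≤⟨ +-monoʳ-≤ S (spread-shift (c ∘ suc) (c zero) (c (suc p)) (Cs ∘ suc) near) ⟩
        S + (spread (c ∘ suc) (c (suc p)) (Cs ∘ suc) + 5 * total (c ∘ suc) (Cs ∘ suc))
          ≤⟨ +-monoʳ-≤ S (+-mono-≤ (spread≤ K) (≤-reflexive (cong (5 *_) (≡.sym (weight≡ K))))) ⟩
        S + (cost (cluster K) + 5 * weight (cluster K)) ∎
    }
    where
    open ≤-Reasoning
    S = cost (Cs zero)
    W = weight (Cs zero)
    eq : ∀ S W → S + W * 0 ≡ S
    eq = solve-∀

  -- With total weight at most n/2 every cluster that arises is light, so merging is possible in
  -- either direction along each link and any centre can be the target.
  collapse : ∀ {k} (c : Fin k → V) → Linked d c → (Cs : Clusters c) → 2 * total c Cs ≤ n → ∀ j → Collapsed c Cs j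
  collapse c root Cs half zero = collapse-single c Cs
  collapse c (attach p near L) Cs half zero =
    collapse-onto-leaf c Cs p near half′ (collapse (c ∘ suc) L (Cs ∘ suc) half′ p)
    where half′ = ≤-trans (*-monoʳ-≤ 2 (m≤n+m _ (weight (Cs zero)))) half
  collapse c (attach p near L) Cs half (suc j) =
    collapse-onto-parent c Cs p light near j
      (collapse (c ∘ suc) L (absorb c Cs p light) (subst (λ t → 2 * t ≤ n) (≡.sym (total-absorb c Cs p light)) half) j)
    where light = ≤-trans (*-monoʳ-≤ 2 (m≤m+n (weight (Cs zero)) _)) half

  -- The chosen vertex is a median of the tree: all branches at it weigh at most n / 2.
  collapse-to-median : ∀ {k} (c : Fin k → V) → Linked d c → (Cs : Clusters c) → total c Cs ≡ n → ∃ (Collapsed c Cs)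
  collapse-to-median c root Cs tot = zero , collapse-single c Cs
  collapse-to-median c (attach p near L) Cs tot with 2 * weight (Cs zero) ≤? n
  ... | yes light with collapse-to-median (c ∘ suc) L (absorb c Cs p light) (≡.trans (total-absorb c Cs p light) tot)
  ...   | j , K = suc j , collapse-onto-parent c Cs p light near j K
  -- A leaf with more than half of the weight is itself the median: the rest is a single light
  -- branch.
  collapse-to-median c (attach p near L) Cs tot | no heavy =
    zero , collapse-onto-leaf c Cs p near half (collapse (c ∘ suc) L (Cs ∘ suc) half p)
    where
    W = weight (Cs zero)
    R = total (c ∘ suc) (Cs ∘ suc)
    double : ∀ a b → a + b + (a + b) ≡ 2 * a + 2 * b
    double = solve-∀
    half : 2 * R ≤ n
    half = +-cancelˡ-≤ n _ _ (begin
      n + 2 * R         ≤⟨ +-monoˡ-≤ (2 * R) (<⇒≤ (≰⇒> heavy)) ⟩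
      2 * W + 2 * R     ≡⟨ double W R ⟨
      W + R + (W + R)   ≡⟨ cong₂ _+_ tot tot ⟩
      n + n             ∎)
      where open ≤-Reasoning

  median-bound : ∀ {k} (c : Fin k → V) → Linked d c → (Cs : Clusters c) → total c Cs ≡ n →
    ∃[ j ] 4 * (M * spread c (c j) Cs) + M * (18 * M + 5 * n) ≤ n * (18 * M + 5 * n) + 8 * (M * M)
  median-bound c L Cs tot with collapse-to-median c L Cs tot
  ... | j , K = j , (begin
    4 * (M * spread c (c j) Cs) + M * Q   ≤⟨ +-monoˡ-≤ _ (*-monoʳ-≤ 4 (*-monoʳ-≤ M (spread≤ K))) ⟩
    4 * (M * cost (cluster K)) + M * Q  ≤⟨ linear (cluster K) ⟩
    weight (cluster K) * Q + 8 * (M * M) ≡⟨ cong (λ w → w * Q + 8 * (M * M)) (≡.trans (weight≡ K) tot) ⟩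
    n * Q + 8 * (M * M) ∎)
    where
    open ≤-Reasoning
    Q = 18 * M + 5 * n

-- Indicators, graph distances and the greedy packing of centres.

𝟙≤1 : ∀ b → 𝟙 b ≤ 1
𝟙≤1 true  = s≤s z≤n
𝟙≤1 false = z≤n

𝟙-mono : {P Q : Set} (p? : Dec P) (q? : Dec Q) → (P → Q) → 𝟙 (does p?) ≤ 𝟙 (does q?)
𝟙-mono (yes p) q? P⇒Q = ≤-reflexive (≡.sym (cong 𝟙 (dec-true q? (P⇒Q p))))
𝟙-mono (no _)  q? P⇒Q = z≤n

𝟙-*-positive : ∀ a b → 0 < 𝟙 a * 𝟙 b → a ≡ true × b ≡ true
𝟙-*-positive true true _ = refl , refl

module _ {n : ℕ} (G : Graph n) where

  snoc : ∀ {k u v w} → Walk G k u v → adj G v w ≡ true → Walk G (suc k) u w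
  snoc here       e = step e here
  snoc (step f p) e = step f (snoc p e)

  reverse : ∀ {k u v} → Walk G k u v → Walk G k v u
  reverse here                     = here
  reverse (step {u = u} {v = v} e p) = snoc (reverse p) (≡.trans (sym G v u) e)

  append : ∀ {k l u v w} → Walk G k u v → Walk G l v w → Walk G (k + l) u w
  append here       q = q
  append (step e p) q = step e (append p q)

  module _ (d : Fin n → Fin n → ℕ) (isDist : ∀ v w → IsDist G v w (d v w)) where

    dist≤walk : ∀ {k v w} → Walk G k v w → d v w ≤ k
    dist≤walk {v = v} {w} p = ≮⇒≥ λ k<d → proj₂ (isDist v w) _ k<d p

    geodesic : ∀ v w → Walk G (d v w) v w
    geodesic v w = proj₁ (isDist v w)

    dist-refl : ∀ x → d x x ≡ 0
    dist-refl x = n≤0⇒n≡0 (dist≤walk here)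

    dist-sym : ∀ x y → d x y ≡ d y x
    dist-sym x y = ≤-antisym (dist≤walk (reverse (geodesic y x))) (dist≤walk (reverse (geodesic x y)))

    dist-triangle : ∀ x y z → d x z ≤ d x y + d y z
    dist-triangle x y z = dist≤walk (append (geodesic x y) (geodesic y z))

    Covered : ∀ {k} → (Fin k → Fin n) → Fin n → Set
    Covered c w = ∃[ i ] d (c i) w ≤ 4

    covered? : ∀ {k} (c : Fin k → Fin n) w → Dec (Covered c w)
    covered? c w = any? (λ i → d (c i) w ≤? 4)

    -- Follow the walk to the first edge entering the covered set. Its outer end is uncovered, yet
    -- one step from a vertex within 4 of a centre, hence within 5 of that centre: it is the next
    -- centre to choose.
    crossing : ∀ {k l} (c : Fin k → Fin n) {w x} → Walk G l w x → ¬ Covered c w → Covered c x →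
               ∃[ u ] ∃[ u′ ] adj G u u′ ≡ true × ¬ Covered c u × Covered c u′
    crossing c here ¬cov cov = contradiction cov ¬cov
    crossing c (step {u = u} {v = v} e p) ¬cov cov with covered? c v
    ... | yes cov′ = u , v , e , ¬cov , cov′
    ... | no ¬cov′ = crossing c p ¬cov′ cov

    -- Contrapositive form of distance at least 5 between distinct centres, which makes their balls
    -- of radius 2 disjoint.
    Separated : ∀ {k} → (Fin k → Fin n) → Set
    Separated c = ∀ i j → d (c i) (c j) ≤ 4 → i ≡ j

    record Packing : Set where
      field
        {order}   : ℕ
        centre    : Fin order → Fin n
        linked    : Linked d centre
        separated : Separated centre
        covering  : ∀ w → Covered centre w

    -- `m` is fuel exceeding the number of uncovered vertices. A new centre is uncovered, hence
    -- separated from the old ones, and covers at least itself, so that number drops.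
    extend : ∀ m {k} (c : Fin (suc k) → Fin n) → Connected G → Linked d c → Separated c →
             ∑ (λ w → 𝟙 (does (¬? (covered? c w)))) < m → Packing
    extend (suc m) c conn L sep (s≤s bound) with any? (λ w → ¬? (covered? c w))
    ... | no none = record
      { centre = c ; linked = L ; separated = sep
      ; covering = λ w → decidable-stable (covered? c w) (λ ¬cov → none (w , ¬cov)) }
    ... | yes (w , ¬cov)
      with crossing c (proj₂ (conn w (c zero))) ¬cov (zero , ≤-trans (≤-reflexive (dist-refl (c zero))) z≤n)
    ...   | u , u′ , e , ¬covᵤ , i , near =
      extend m (u ∷ c) conn
        (attach i (≤-trans (dist-triangle u u′ (c i))
          (+-mono-≤ (dist≤walk (step e here)) (≤-trans (≤-reflexive (dist-sym u′ (c i))) near))) L)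
        separated′
        (≤-trans (∑-mono-< fewer u (≤-reflexive (≡.trans
          (cong (suc ∘ 𝟙) (dec-false (¬? (covered? (u ∷ c) u)) (λ ¬cov′ → ¬cov′ (zero , ≤-trans (≤-reflexive (dist-refl u)) z≤n))))
          (≡.sym (cong 𝟙 (dec-true (¬? (covered? c u)) ¬covᵤ)))))) bound)
      where
      separated′ : Separated (u ∷ c)
      separated′ zero    zero    _  = refl
      separated′ zero    (suc j) le = contradiction (j , ≤-trans (≤-reflexive (dist-sym (c j) u)) le) ¬covᵤ
      separated′ (suc i) zero    le = contradiction (i , le) ¬covᵤ
      separated′ (suc i) (suc j) le = cong suc (sep i j le)
      fewer : ∀ w → 𝟙 (does (¬? (covered? (u ∷ c) w))) ≤ 𝟙 (does (¬? (covered? c w)))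
      fewer w = 𝟙-mono (¬? (covered? (u ∷ c) w)) (¬? (covered? c w)) (λ ¬cov′ (j , le) → ¬cov′ (suc j , le))

    packing : Connected G → Fin n → Packing
    packing conn v = extend _ {0} (λ _ → v) conn root (λ { zero zero _ → refl }) (n<1+n _)

    -- Two centres within 2 of `w` are within 4 of each other, so `Separated` identifies them. The
    -- last component puts the whole ball of a centre into its cell.
    home : (P : Packing) (let open Packing P) → ∀ w →
           ∃[ i ] d (centre i) w ≤ 4 × (∀ j → d (centre j) w ≤ 2 → j ≡ i)
    home P w with any? (λ i → d (Packing.centre P i) w ≤? 2)
    ... | no none with Packing.covering P w
    ...   | i , le = i , le , λ j le₂ → contradiction (j , le₂) none
    home P w | yes (i , le) = i , ≤-trans le (s≤s (s≤s z≤n)) , λ j le₂ →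
      Packing.separated P j i (≤-trans (dist-triangle _ w _)
        (+-mono-≤ le₂ (≤-trans (≤-reflexive (dist-sym w _)) le)))

    -- Balls and cells: the initial clusters given by a packing.

    ball : Fin n → ℕ
    ball a = ∑ (λ w → 𝟙 (does (d a w ≤? 2)))

    module _ (M : ℕ) (M≤ball : ∀ a → M ≤ ball a) (P : Packing) where

      open Packing P
      open Clustering d dist-refl dist-sym dist-triangle n M

      assigned : Fin n → Fin order
      assigned w = proj₁ (home P w)

      cell-sum : (Fin n → ℕ) → Fin order → ℕ
      cell-sum g i = ∑ (λ w → 𝟙 (does (assigned w Fin.≟ i)) * g w)

      -- Exchange the sums: for fixed `w` only the cell `assigned w` contributes.
      ∑-cell-sum : ∀ (g : Fin order → Fin n → ℕ) → ∑ (λ i → cell-sum (g i) i) ≡ ∑ (λ w → g (assigned w) w)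
      ∑-cell-sum g = ≡.trans (∑-comm (λ i w → 𝟙 (does (assigned w Fin.≟ i)) * g i w))
        (sum-cong-≗ (λ w → ∑-diagonal (assigned w) (λ i → g i w)))

      ball≤cell : ∀ i → ball (centre i) ≤ cell-sum (λ _ → 1) i
      ball≤cell i = ∑-mono λ w → ≤-trans
        (𝟙-mono (d (centre i) w ≤? 2) (assigned w Fin.≟ i) (λ le → ≡.sym (proj₂ (proj₂ (home P w)) i le)))
        (≤-reflexive (≡.sym (*-identityʳ _)))

      -- Every vertex of the cell is within 4 of the centre, and each vertex of the ball, all of
      -- them in the cell, saves at least 2.
      cell-cost : ∀ i → cell-sum (d (centre i)) i + 2 * ball (centre i) ≤ 4 * cell-sum (λ _ → 1) i
      cell-cost i = begin
        cell-sum (d (centre i)) i + 2 * ball (centre i)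
          ≡⟨ cong (cell-sum (d (centre i)) i +_) (*-distribˡ-sum 2 (λ w → 𝟙 (does (d (centre i) w ≤? 2)))) ⟩
        cell-sum (d (centre i)) i + ∑ (λ w → 2 * 𝟙 (does (d (centre i) w ≤? 2)))
          ≡⟨ ∑-distrib-+ (λ w → 𝟙 (does (assigned w Fin.≟ i)) * d (centre i) w) (λ w → 2 * 𝟙 (does (d (centre i) w ≤? 2))) ⟨
        ∑ (λ w → 𝟙 (does (assigned w Fin.≟ i)) * d (centre i) w + 2 * 𝟙 (does (d (centre i) w ≤? 2)))
          ≤⟨ ∑-mono pointwise ⟩
        ∑ (λ w → 4 * (𝟙 (does (assigned w Fin.≟ i)) * 1))
          ≡⟨ *-distribˡ-sum 4 (λ w → 𝟙 (does (assigned w Fin.≟ i)) * 1) ⟨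
        4 * cell-sum (λ _ → 1) i ∎
        where
        open ≤-Reasoning
        weigh : {A B : Set} (a? : Dec A) (b? : Dec B) (D : ℕ) → (B → A × D ≤ 2) → (A → D ≤ 4) →
                𝟙 (does a?) * D + 2 * 𝟙 (does b?) ≤ 4 * (𝟙 (does a?) * 1)
        weigh (yes _) (yes b) D inner _ = +-monoˡ-≤ 2 (≤-trans (≤-reflexive (*-identityˡ D)) (proj₂ (inner b)))
        weigh (yes a) (no _)  D _ outer = ≤-trans (≤-reflexive (≡.trans (+-identityʳ _) (*-identityˡ D))) (outer a)
        weigh (no ¬a) (yes b) D inner _ = contradiction (proj₁ (inner b)) ¬a
        weigh (no _)  (no _)  D _ _     = z≤n
        pointwise : ∀ w → 𝟙 (does (assigned w Fin.≟ i)) * d (centre i) w + 2 * 𝟙 (does (d (centre i) w ≤? 2)) ≤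
                          4 * (𝟙 (does (assigned w Fin.≟ i)) * 1)
        pointwise w = weigh (assigned w Fin.≟ i) (d (centre i) w ≤? 2) (d (centre i) w)
          (λ le → ≡.sym (proj₂ (proj₂ (home P w)) i le) , le)
          (λ { refl → proj₁ (proj₂ (home P w)) })

      cells : Clusters centre
      cells i = initial (cell-sum (λ _ → 1) i) (cell-sum (d (centre i)) i)
        (≤-trans (M≤ball (centre i)) (ball≤cell i))
        (≤-trans (+-monoʳ-≤ (cell-sum (d (centre i)) i) (*-monoʳ-≤ 2 (M≤ball (centre i)))) (cell-cost i))

      total-cells : ∑ (cell-sum (λ _ → 1)) ≡ n
      total-cells = ≡.trans (∑-cell-sum (λ _ _ → 1)) (∑-one n)

      transmission≤spread : ∀ x → ∑ (d x) ≤
        ∑ (λ i → cell-sum (d (centre i)) i + cell-sum (λ _ → 1) i * d x (centre i))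
      transmission≤spread x = begin
        ∑ (d x)
          ≤⟨ ∑-mono (λ w → ≤-trans (dist-triangle x (centre (assigned w)) w) (≤-reflexive (+-comm (d x _) _))) ⟩
        ∑ (λ w → d (centre (assigned w)) w + d x (centre (assigned w)))
          ≡⟨ ∑-cell-sum (λ i w → d (centre i) w + d x (centre i)) ⟨
        ∑ (λ i → cell-sum (λ w → d (centre i) w + d x (centre i)) i)
          ≡⟨ sum-cong-≗ split ⟩
        ∑ (λ i → cell-sum (d (centre i)) i + cell-sum (λ _ → 1) i * d x (centre i)) ∎
        where
        open ≤-Reasoning
        distribute : ∀ b p q → b * (p + q) ≡ b * p + b * 1 * q
        distribute = solve-∀
        split : ∀ i → cell-sum (λ w → d (centre i) w + d x (centre i)) i ≡
                      cell-sum (d (centre i)) i + cell-sum (λ _ → 1) i * d x (centre i)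
        split i = ≡.trans
          (sum-cong-≗ (λ w → distribute (𝟙 (does (assigned w Fin.≟ i))) (d (centre i) w) (d x (centre i))))
          (≡.trans (∑-distrib-+ (λ w → 𝟙 (does (assigned w Fin.≟ i)) * d (centre i) w) _)
            (cong (cell-sum (d (centre i)) i +_) (≡.sym (*-distribʳ-sum (d x (centre i)) (λ w → 𝟙 (does (assigned w Fin.≟ i)) * 1)))))

      light-vertex : ∃[ x ] 4 * (M * ∑ (d x)) + M * (18 * M + 5 * n) ≤ n * (18 * M + 5 * n) + 8 * (M * M)
      light-vertex with median-bound centre linked cells total-cells
      ... | j , bound = centre j ,
        ≤-trans (+-monoˡ-≤ _ (*-monoʳ-≤ 4 (*-monoʳ-≤ M (transmission≤spread (centre j))))) bound

  -- Size of balls of radius 2 in a C₄-free graph.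

  degree≡∑ : ∀ a → degree G a ≡ ∑ (λ w → 𝟙 (adj G a w))
  degree≡∑ a = sum-allFin (λ w → 𝟙 (adj G a w))

  common : Fin n → Fin n → ℕ
  common a w = ∑ (λ u → 𝟙 (adj G a u) * 𝟙 (adj G u w))

  -- Double counting of the two-step walks from `a`: by end vertex they give the right side, by
  -- middle vertex each of the `degree G a` choices has at least `δ` continuations.
  ∑-common : ∀ δ → (∀ v → δ ≤ degree G v) → ∀ a → degree G a * δ ≤ ∑ (common a)
  ∑-common δ δ≤ a = begin
    degree G a * δ                         ≡⟨ cong (_* δ) (degree≡∑ a) ⟩
    ∑ (λ u → 𝟙 (adj G a u)) * δ            ≡⟨ *-distribʳ-sum δ (λ u → 𝟙 (adj G a u)) ⟩
    ∑ (λ u → 𝟙 (adj G a u) * δ)            ≤⟨ ∑-mono (λ u → *-monoʳ-≤ (𝟙 (adj G a u)) (≤-trans (δ≤ u) (≤-reflexive (degree≡∑ u)))) ⟩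
    ∑ (λ u → 𝟙 (adj G a u) * ∑ (λ w → 𝟙 (adj G u w)))
      ≡⟨ sum-cong-≗ (λ u → *-distribˡ-sum (𝟙 (adj G a u)) (λ w → 𝟙 (adj G u w))) ⟩
    ∑ (λ u → ∑ (λ w → 𝟙 (adj G a u) * 𝟙 (adj G u w)))
      ≡⟨ ∑-comm (λ u w → 𝟙 (adj G a u) * 𝟙 (adj G u w)) ⟩
    ∑ (common a) ∎
    where open ≤-Reasoning

  -- Twice the number of edges inside the neighbourhood of a.
  link : Fin n → ℕ
  link a = ∑ (λ w → 𝟙 (adj G a w) * common a w)

  link-even : ∀ a → ∃[ m ] link a ≡ 2 * m
  link-even a with ∑-symmetric-even (λ w u → 𝟙 (adj G a w) * (𝟙 (adj G a u) * 𝟙 (adj G u w))) diagonal symmetric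
    where
    diagonal : ∀ w → 𝟙 (adj G a w) * (𝟙 (adj G a w) * 𝟙 (adj G w w)) ≡ 0
    diagonal w rewrite irrefl G w | *-zeroʳ (𝟙 (adj G a w)) = *-zeroʳ (𝟙 (adj G a w))
    exchange : ∀ x y z → x * (y * z) ≡ y * (x * z)
    exchange = solve-∀
    symmetric : ∀ w u → 𝟙 (adj G a w) * (𝟙 (adj G a u) * 𝟙 (adj G u w)) ≡
                        𝟙 (adj G a u) * (𝟙 (adj G a w) * 𝟙 (adj G w u))
    symmetric w u rewrite sym G u w = exchange (𝟙 (adj G a w)) (𝟙 (adj G a u)) (𝟙 (adj G w u))
  ... | m , eq = m , ≡.trans
    (sum-cong-≗ (λ w → *-distribˡ-sum (𝟙 (adj G a w)) (λ u → 𝟙 (adj G a u) * 𝟙 (adj G u w)))) eq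

  adj⇒≢ : ∀ {u v} → adj G u v ≡ true → u ≢ v
  adj⇒≢ {u} e refl with ≡.trans (≡.sym e) (irrefl G u)
  ... | ()

  module _ (c4 : C4Free G) where

    -- Two common neighbours `u` and `v` would close the 4-cycle `a`, `u`, `w`, `v`.
    common≤1 : ∀ {a w} → a ≢ w → common a w ≤ 1
    common≤1 {a} {w} a≢w = ∑-at-most-one _
      (λ u → *-mono-≤ (𝟙≤1 (adj G a u)) (𝟙≤1 (adj G u w))) unique
      where
      unique : ∀ u v → 0 < 𝟙 (adj G a u) * 𝟙 (adj G u w) → 0 < 𝟙 (adj G a v) * 𝟙 (adj G v w) → u ≡ v
      unique u v p q with u Fin.≟ v | 𝟙-*-positive (adj G a u) _ p | 𝟙-*-positive (adj G a v) _ q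
      ... | yes u≡v | _ | _ = u≡v
      ... | no u≢v | au , uw | av , vw = ⊥-elim (c4 a u w v
        (adj⇒≢ au) a≢w (adj⇒≢ av) (adj⇒≢ uw) u≢v (adj⇒≢ vw ∘ ≡.sym)
        au uw (≡.trans (sym G w v) vw) (≡.trans (sym G v a) av))

    link≤degree : ∀ a → link a ≤ degree G a
    link≤degree a = ≤-trans (∑-mono pointwise) (≤-reflexive (≡.sym (degree≡∑ a)))
      where
      pointwise : ∀ w → 𝟙 (adj G a w) * common a w ≤ 𝟙 (adj G a w)
      pointwise w with adj G a w in e
      ... | true  = ≤-trans (≤-reflexive (+-identityʳ _)) (common≤1 (adj⇒≢ e))
      ... | false = z≤n

    module _ (d : Fin n → Fin n → ℕ) (isDist : ∀ v w → IsDist G v w (d v w)) where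

      -- The ball count, vertex by vertex. At `w = a` the two-step walks number the degree, which
      -- the last term on the right absorbs; at a neighbour they are the `link` term; elsewhere
      -- there is at most one, and none outside the ball.
      ball-pointwise : ∀ a w →
        common a w + 𝟙 (adj G a w) + 𝟙 (does (a Fin.≟ w)) * 1 ≤
        𝟙 (does (d a w ≤? 2)) + 𝟙 (adj G a w) * common a w + 𝟙 (does (a Fin.≟ w)) * ∑ (λ u → 𝟙 (adj G a u))
      ball-pointwise a w = go (a Fin.≟ w) (d a w ≤? 2) (adj G a w) refl
        where
        walk₂ : ∀ u → 0 < 𝟙 (adj G a u) * 𝟙 (adj G u w) → d a w ≤ 2
        walk₂ u p with 𝟙-*-positive (adj G a u) (adj G u w) p
        ... | au , uw = dist≤walk d isDist (step au (step uw here))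
        none : ¬ d a w ≤ 2 → common a w ≡ 0
        none far = ∑-zero (λ u → n≤0⇒n≡0 (≮⇒≥ (far ∘ walk₂ u)))
        go : (a≟w : Dec (a ≡ w)) (near? : Dec (d a w ≤ 2)) (b : Bool) → adj G a w ≡ b →
             common a w + 𝟙 b + 𝟙 (does a≟w) * 1 ≤
             𝟙 (does near?) + 𝟙 b * common a w + 𝟙 (does a≟w) * ∑ (λ u → 𝟙 (adj G a u))
        go (yes refl) near? true e = contradiction refl (adj⇒≢ e)
        go (yes refl) (no far) false e = contradiction (≤-trans (≤-reflexive (dist-refl d isDist a)) z≤n) far
        go (yes refl) (yes near) false e = begin
          common a a + 0 + 1  ≡⟨ cong (_+ 1) (+-identityʳ _) ⟩
          common a a + 1      ≡⟨ +-comm _ 1 ⟩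
          1 + common a a      ≤⟨ +-monoʳ-≤ 1 (∑-mono (λ u → ≤-trans (*-monoʳ-≤ (𝟙 (adj G a u)) (𝟙≤1 (adj G u a))) (≤-reflexive (*-identityʳ _)))) ⟩
          1 + ∑ (λ u → 𝟙 (adj G a u)) ≡⟨ cong suc (+-identityʳ _) ⟨
          1 + (∑ (λ u → 𝟙 (adj G a u)) + 0) ∎
          where open ≤-Reasoning
        go (no a≢w) (no far) true e = contradiction (≤-trans (dist≤walk d isDist (step e here)) (s≤s z≤n)) far
        go (no a≢w) (yes near) true e = ≤-reflexive (eq (common a w))
          where
          eq : ∀ x → x + 1 + 0 ≡ 1 + (x + 0) + 0
          eq = solve-∀
        go (no a≢w) (no far) false e = ≤-reflexive (cong (λ x → x + 0 + 0) (none far))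
        go (no a≢w) (yes near) false e =
          ≤-trans (≤-reflexive (≡.trans (+-identityʳ _) (+-identityʳ _))) (common≤1 a≢w)

      -- Sum `ball-pointwise` over `w`. The degree `D` arises on the left from the neighbours and on
      -- the right from `w = a`, and cancels.
      ball-link : ∀ δ → (∀ v → δ ≤ degree G v) → ∀ a → 1 + degree G a * δ ≤ ball d isDist a + link a
      ball-link δ δ≤ a = +-cancelʳ-≤ D _ _ (begin
        1 + degree G a * δ + D
          ≡⟨ eq (degree G a * δ) D ⟩
        degree G a * δ + D + 1
          ≤⟨ +-monoˡ-≤ 1 (+-monoˡ-≤ D (∑-common δ δ≤ a)) ⟩
        ∑ (common a) + D + 1
          ≡⟨ cong₂ _+_ (∑-distrib-+ (common a) (λ w → 𝟙 (adj G a w))) (∑-diagonal a (λ _ → 1)) ⟨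
        ∑ (λ w → common a w + 𝟙 (adj G a w)) + ∑ (λ w → 𝟙 (does (a Fin.≟ w)) * 1)
          ≡⟨ ∑-distrib-+ (λ w → common a w + 𝟙 (adj G a w)) (λ w → 𝟙 (does (a Fin.≟ w)) * 1) ⟨
        ∑ (λ w → common a w + 𝟙 (adj G a w) + 𝟙 (does (a Fin.≟ w)) * 1)
          ≤⟨ ∑-mono (ball-pointwise a) ⟩
        ∑ (λ w → 𝟙 (does (d a w ≤? 2)) + 𝟙 (adj G a w) * common a w + 𝟙 (does (a Fin.≟ w)) * D)
          ≡⟨ ∑-distrib-+ (λ w → 𝟙 (does (d a w ≤? 2)) + 𝟙 (adj G a w) * common a w) (λ w → 𝟙 (does (a Fin.≟ w)) * D) ⟩
        ∑ (λ w → 𝟙 (does (d a w ≤? 2)) + 𝟙 (adj G a w) * common a w) + ∑ (λ w → 𝟙 (does (a Fin.≟ w)) * D)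
          ≡⟨ cong₂ _+_ (∑-distrib-+ (λ w → 𝟙 (does (d a w ≤? 2))) (λ w → 𝟙 (adj G a w) * common a w)) (∑-diagonal a (λ _ → D)) ⟩
        ball d isDist a + link a + D ∎)
        where
        open ≤-Reasoning
        D = ∑ (λ w → 𝟙 (adj G a w))
        eq : ∀ x y → 1 + x + y ≡ x + y + 1
        eq = solve-∀

      -- Write the degree as `δ + t`. If `t = 0`, the even number `link a` is at most `δ`, hence at
      -- most `2 * (δ / 2)`. If `t > 0`, the surplus `t * δ` of two-step walks outweighs the excess
      -- of `link a`, which is at most `1 + t`.
      ball-size : ∀ δ → 3 ≤ δ → (∀ v → δ ≤ degree G v) → ∀ a → suc (δ * δ ∸ 2 * (δ / 2)) ≤ ball d isDist a
      ball-size δ 3≤δ δ≤ a with link-even a | link≤degree a | ball-link δ δ≤ a | m≤n⇒∃[o]m+o≡n (δ≤ a)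
      ... | m , link≡ | link≤ | size | t , D≡ =
        -- As `2 * (δ / 2) ≤ δ * δ`, the `suc` moves inside the truncated subtraction, which then
        -- becomes an addition on the other side.
        subst (_≤ ball d isDist a) (+-∸-assoc 1 h≤δδ) (m≤n+o⇒m∸n≤o (1 + δ * δ) (2 * (δ / 2)) (+-cancelʳ-≤ (2 * m) _ _ (begin
          1 + δ * δ + 2 * m                     ≤⟨ +-monoʳ-≤ (1 + δ * δ) (pairs t D≡) ⟩
          1 + δ * δ + (2 * (δ / 2) + t * δ)     ≡⟨ eq (δ * δ) (2 * (δ / 2)) (t * δ) ⟩
          2 * (δ / 2) + (1 + (δ * δ + t * δ))   ≡⟨ cong (λ x → 2 * (δ / 2) + (1 + x)) (≡.trans (≡.sym (*-distribʳ-+ δ δ t)) (cong (_* δ) D≡)) ⟩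
          2 * (δ / 2) + (1 + degree G a * δ)    ≤⟨ +-monoʳ-≤ (2 * (δ / 2)) size ⟩
          2 * (δ / 2) + (ball d isDist a + link a) ≡⟨ cong (λ x → 2 * (δ / 2) + (ball d isDist a + x)) link≡ ⟩
          2 * (δ / 2) + (ball d isDist a + 2 * m)  ≡⟨ +-assoc (2 * (δ / 2)) _ _ ⟨
          2 * (δ / 2) + ball d isDist a + 2 * m ∎)))
        where
        open ≤-Reasoning
        eq : ∀ x y z → 1 + x + (y + z) ≡ y + (1 + (x + z))
        eq = solve-∀
        2h≤δ : 2 * (δ / 2) ≤ δ
        2h≤δ = ≤-trans (≤-reflexive (*-comm 2 (δ / 2))) (m/n*n≤m δ 2)
        h≤δδ : 2 * (δ / 2) ≤ δ * δ
        h≤δδ = ≤-trans 2h≤δ (m≤m*n δ δ {{>-nonZero (≤-trans (s≤s z≤n) 3≤δ)}})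
        pairs : ∀ t → δ + t ≡ degree G a → 2 * m ≤ 2 * (δ / 2) + t * δ
        pairs zero D≡ = ≤-trans (*-monoʳ-≤ 2 (subst (_≤ δ / 2) (m*n/n≡m m 2) (/-monoˡ-≤ 2 (begin
          m * 2      ≡⟨ *-comm m 2 ⟩
          2 * m      ≡⟨ link≡ ⟨
          link a     ≤⟨ link≤ ⟩
          degree G a ≡⟨ D≡ ⟨
          δ + 0      ≡⟨ +-identityʳ δ ⟩
          δ          ∎)))) (m≤m+n _ 0)
        pairs (suc t) D≡ = begin
          2 * m       ≡⟨ link≡ ⟨
          link a      ≤⟨ link≤ ⟩
          degree G a  ≡⟨ D≡ ⟨
          δ + suc t   ≡⟨ cong (_+ suc t) (m≡m%n+[m/n]*n δ 2) ⟩
          δ % 2 + δ / 2 * 2 + suc t ≤⟨ +-monoˡ-≤ (suc t) (+-monoˡ-≤ (δ / 2 * 2) (s≤s⁻¹ (m%n<n δ 2))) ⟩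
          1 + δ / 2 * 2 + suc t     ≡⟨ eq₂ (δ / 2) t ⟩
          2 * (δ / 2) + (2 + t)     ≤⟨ +-monoʳ-≤ (2 * (δ / 2)) (+-monoʳ-≤ 2 (m≤m*n t 2)) ⟩
          2 * (δ / 2) + suc t * 2   ≤⟨ +-monoʳ-≤ (2 * (δ / 2)) (*-monoʳ-≤ (suc t) (≤-trans (n≤1+n 2) 3≤δ)) ⟩
          2 * (δ / 2) + suc t * δ   ∎
          where
          eq₂ : ∀ h t → 1 + h * 2 + suc t ≡ 2 * h + (2 + t)
          eq₂ = solve-∀

-- From the transmission bound to rational arithmetic.

-- With N = ⌊n / M⌋ one has M N ≥ n - M + 1; X is the slack of that inequality.
scaled-bound : ∀ n′ M N T → 2 ≤ M → 1 + suc n′ ≤ M + N * M →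
  4 * (M * T) + M * (18 * M + 5 * suc n′) ≤ suc n′ * (18 * M + 5 * suc n′) + 8 * (M * M) →
  32 * T ≤ n′ * (40 * N + 147)
scaled-bound n′ (suc (suc m)) N T (s≤s (s≤s z≤n)) quotient bound with m≤n⇒∃[o]m+o≡n quotient
... | X , X≡ = *-cancelˡ-≤ M (+-cancelʳ-≤ (8 * (M * Q) + 40 * n′ * M) _ _ (begin
  M * (32 * T) + (8 * (M * Q) + 40 * n′ * M)   ≡⟨ eq₁ M T Q n′ ⟩
  8 * (4 * (M * T) + M * Q) + 40 * n′ * M      ≤⟨ +-monoˡ-≤ _ (*-monoʳ-≤ 8 bound) ⟩
  -- The added term is the exact slack `40n′X + 3Mn′ + 80M² - 104M - 40`; substituting `M = 2 + m`
  -- makes all coefficients nonnegative.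
  8 * (n * Q + 8 * (M * M)) + 40 * n′ * M      ≤⟨ m≤m+n _ (40 * n′ * X + 3 * (M * n′) + 72 + 216 * m + 80 * (m * m)) ⟩
  8 * (n * Q + 8 * (M * M)) + 40 * n′ * M + (40 * n′ * X + 3 * (M * n′) + 72 + 216 * m + 80 * (m * m))
    ≡⟨ eq₂ m n′ X ⟩
  40 * n′ * (1 + n + X) + 147 * (M * n′) + 8 * (M * Q)
    ≡⟨ cong (λ x → 40 * n′ * x + 147 * (M * n′) + 8 * (M * Q)) X≡ ⟩
  40 * n′ * (M + N * M) + 147 * (M * n′) + 8 * (M * Q) ≡⟨ eq₃ M N n′ Q ⟩
  M * (n′ * (40 * N + 147)) + (8 * (M * Q) + 40 * n′ * M) ∎))
  where
  open ≤-Reasoning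
  n = suc n′
  M = suc (suc m)
  Q = 18 * M + 5 * n
  eq₁ : ∀ M T Q n′ → M * (32 * T) + (8 * (M * Q) + 40 * n′ * M) ≡ 8 * (4 * (M * T) + M * Q) + 40 * n′ * M
  eq₁ = solve-∀
  eq₂ : ∀ m n′ X →
    8 * ((1 + n′) * (18 * (2 + m) + 5 * (1 + n′)) + 8 * ((2 + m) * (2 + m))) + 40 * n′ * (2 + m) +
    (40 * n′ * X + 3 * ((2 + m) * n′) + 72 + 216 * m + 80 * (m * m)) ≡
    40 * n′ * (1 + (1 + n′) + X) + 147 * ((2 + m) * n′) + 8 * ((2 + m) * (18 * (2 + m) + 5 * (1 + n′)))
  eq₂ = solve-∀
  eq₃ : ∀ M N n′ Q → 40 * n′ * (M + N * M) + 147 * (M * n′) + 8 * (M * Q) ≡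
                     M * (n′ * (40 * N + 147)) + (8 * (M * Q) + 40 * n′ * M)
  eq₃ = solve-∀

minFin-≤ : ∀ {k} (f : Fin (suc k) → ℚ) i → minFin f ℚ.≤ f i
minFin-≤ {zero}  f zero    = ℚ.≤-refl
minFin-≤ {suc k} f zero    = ℚ.p⊓q≤p (f zero) _
minFin-≤ {suc k} f (suc i) = ℚ.≤-trans (ℚ.p⊓q≤q (f zero) _) (minFin-≤ (f ∘ suc) i)

open import Data.Integer using (+_)

-- For unnormalised rationals the inequality is plain cross multiplication; `toℚᵘ` respects the
-- operations and reflects the order.
fromℚᵘ-affine-≤ : ∀ p q r s → s ℚᵘ.≤ p ℚᵘ.* q ℚᵘ.+ r →
                  ℚ.fromℚᵘ s ℚ.≤ ℚ.fromℚᵘ p ℚ.* ℚ.fromℚᵘ q ℚ.+ ℚ.fromℚᵘ r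
fromℚᵘ-affine-≤ p q r s s≤ = ℚ.toℚᵘ-cancel-≤ (begin
  ℚ.toℚᵘ s′                       ≃⟨ ℚ.toℚᵘ-fromℚᵘ s ⟩
  s                               ≤⟨ s≤ ⟩
  p ℚᵘ.* q ℚᵘ.+ r                 ≃⟨ ℚᵘ.+-cong (ℚᵘ.*-cong (ℚ.toℚᵘ-fromℚᵘ p) (ℚ.toℚᵘ-fromℚᵘ q)) (ℚ.toℚᵘ-fromℚᵘ r) ⟨
  ℚ.toℚᵘ p′ ℚᵘ.* ℚ.toℚᵘ q′ ℚᵘ.+ ℚ.toℚᵘ r′ ≃⟨ ℚᵘ.+-congˡ (ℚ.toℚᵘ r′) (ℚ.toℚᵘ-homo-* p′ q′) ⟨
  ℚ.toℚᵘ (p′ ℚ.* q′) ℚᵘ.+ ℚ.toℚᵘ r′ ≃⟨ ℚ.toℚᵘ-homo-+ (p′ ℚ.* q′) r′ ⟨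
  ℚ.toℚᵘ (p′ ℚ.* q′ ℚ.+ r′)       ∎)
  where
  open ℚᵘ.≤-Reasoning
  p′ = ℚ.fromℚᵘ p
  q′ = ℚ.fromℚᵘ q
  r′ = ℚ.fromℚᵘ r
  s′ = ℚ.fromℚᵘ s

avg-≤ : ∀ T k N → 32 * T ≤ suc k * (40 * N + 147) →
        avg T (suc k) ℚ.≤ ((+ 5) ℚ./ 4) ℚ.* ((+ N) ℚ./ 1) ℚ.+ ((+ 147) ℚ./ 32)
avg-≤ T k N bound = fromℚᵘ-affine-≤
  (ℚᵘ.mkℚᵘ (+ 5) 3) (ℚᵘ.mkℚᵘ (+ N) 0) (ℚᵘ.mkℚᵘ (+ 147) 31) (ℚᵘ.mkℚᵘ (+ T) k) (ℚᵘ.*≤* cross)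
  where
  -- 128 is the product of the denominators 4, 1 and 32; both sides are four times those of `bound`.
  cross : (+ T) ℤ.* (+ 128) ℤ.≤ ((+ 5) ℤ.* (+ N) ℤ.* (+ 32) ℤ.+ (+ 147) ℤ.* (+ 4)) ℤ.* (+ suc k)
  cross = subst₂ ℤ._≤_ left right (ℤ.+≤+ (*-monoʳ-≤ 4 bound))
    where
    eq₁ : ∀ T → 4 * (32 * T) ≡ T * 128
    eq₁ = solve-∀
    eq₂ : ∀ k N → 4 * ((1 + k) * (40 * N + 147)) ≡ (5 * N * 32 + 147 * 4) * (1 + k)
    eq₂ = solve-∀
    left : + (4 * (32 * T)) ≡ (+ T) ℤ.* (+ 128)
    left = ≡.trans (cong +_ (eq₁ T)) (ℤ.pos-* T 128)
    right : + (4 * (suc k * (40 * N + 147))) ≡ ((+ 5) ℤ.* (+ N) ℤ.* (+ 32) ℤ.+ (+ 147) ℤ.* (+ 4)) ℤ.* (+ suc k)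
    right = ≡.trans (cong +_ (eq₂ k N)) (≡.trans (ℤ.pos-* (5 * N * 32 + 147 * 4) (suc k))
      (cong (ℤ._* (+ suc k)) (≡.trans (ℤ.pos-+ (5 * N * 32) (147 * 4))
        (cong (ℤ._+ (+ 588)) (≡.trans (ℤ.pos-* (5 * N) 32) (cong (ℤ._* (+ 32)) (ℤ.pos-* 5 N)))))))

proximity-≤ : ∀ {k} (d : Fin (suc (suc k)) → Fin (suc (suc k)) → ℕ) x N →
              32 * ∑ (d x) ≤ suc k * (40 * N + 147) →
              proximity d ℚ.≤ ((+ 5) ℚ./ 4) ℚ.* ((+ N) ℚ./ 1) ℚ.+ ((+ 147) ℚ./ 32)
proximity-≤ {k} d x N bound = ℚ.≤-trans (minFin-≤ (avgDist d) x) (avg-≤ (transmission d x) k N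
  (subst (λ T → 32 * T ≤ suc k * (40 * N + 147)) (≡.sym (sum-allFin (d x))) bound))

-- Assembly of the bound on the proximity.

ball≤order : ∀ {n} (G : Graph n) d isDist a → ball G d isDist a ≤ n
ball≤order {n} G d isDist a = ≤-trans (∑-mono (λ w → 𝟙≤1 (does (d a w ≤? 2)))) (≤-reflexive (∑-one n))

2≤ball-bound : ∀ δ → 3 ≤ δ → 2 ≤ suc (δ * δ ∸ 2 * (δ / 2))
2≤ball-bound δ 3≤δ = s≤s (m<n⇒0<n∸m (begin-strict
  2 * (δ / 2) ≡⟨ *-comm 2 (δ / 2) ⟩
  δ / 2 * 2   ≤⟨ m/n*n≤m δ 2 ⟩
  δ           ≡⟨ *-identityʳ δ ⟨
  δ * 1       <⟨ *-monoʳ-< δ {{>-nonZero (≤-trans (s≤s z≤n) 3≤δ)}} (≤-trans (s≤s (s≤s z≤n)) 3≤δ) ⟩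
  δ * δ       ∎))
  where open ≤-Reasoning

light-vertex-scaled : ∀ {n′} (M : ℕ) .{{_ : NonZero M}} (let n = suc n′) (G : Graph n)
  (d : Fin n → Fin n → ℕ) (isDist : ∀ v w → IsDist G v w (d v w)) →
  2 ≤ M → (∀ a → M ≤ ball G d isDist a) → Packing G d isDist →
  ∃[ x ] 32 * ∑ (d x) ≤ n′ * (40 * (n / M) + 147)
light-vertex-scaled {n′} M G d isDist 2≤M M≤ball P =
  x , scaled-bound n′ M (n / M) (∑ (d x)) 2≤M quotient (proj₂ light)
  where
  open ≤-Reasoning
  n = suc n′
  light = light-vertex G d isDist M M≤ball P
  x = proj₁ light
  quotient : 1 + n ≤ M + n / M * M
  quotient = begin
    1 + n                   ≡⟨ cong suc (m≡m%n+[m/n]*n n M) ⟩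
    1 + n % M + n / M * M   ≤⟨ +-monoˡ-≤ (n / M * M) (m%n<n n M) ⟩
    M + n / M * M           ∎

proximity-packing-≤ : ∀ {n} (M : ℕ) .{{_ : NonZero M}} (G : Graph n) (d : Fin n → Fin n → ℕ)
  (isDist : ∀ v w → IsDist G v w (d v w)) → 2 ≤ M → (∀ a → M ≤ ball G d isDist a) →
  Connected G → Fin n →
  proximity d ℚ.≤ ((+ 5) ℚ./ 4) ℚ.* ((+ (n / M)) ℚ./ 1) ℚ.+ ((+ 147) ℚ./ 32)
-- A ball of at least two vertices does not fit into a graph of order 1, so the average is always
-- over `n - 1 > 0` vertices.
proximity-packing-≤ {suc zero} M G d isDist 2≤M M≤ball conn v =
  contradiction (≤-trans 2≤M (≤-trans (M≤ball v) (ball≤order G d isDist v))) 1+n≰n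
proximity-packing-≤ {suc (suc k)} M G d isDist 2≤M M≤ball conn v =
  proximity-≤ d (proj₁ light) (suc (suc k) / M) (proj₂ light)
  where light = light-vertex-scaled M G d isDist 2≤M M≤ball (packing G d isDist conn v)

theorem6p4 : (n δ : ℕ) → 3 ≤ δ → (G : Graph n) → Connected G → C4Free G →
    MinDegree G δ →
    (d : Fin n → Fin n → ℕ) → (∀ v w → IsDist G v w (d v w)) →
    proximity d ℚ.≤
    ((+ 5) ℚ./ 4) ℚ.* ((+ (n / suc (δ * δ ∸ 2 * (δ / 2)))) ℚ./ 1)
    ℚ.+ ((+ 147) ℚ./ 32)
theorem6p4 n δ 3≤δ G conn c4 (δ≤ , v , _) d isDist =
  proximity-packing-≤ (suc (δ * δ ∸ 2 * (δ / 2))) G d isDist (2≤ball-bound δ 3≤δ)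
    (ball-size G c4 d isDist δ 3≤δ δ≤) conn v
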